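{- Let $* \in \{\mathrm{base}, \mathrm{base}\langle\Sigma\rangle, \mathrm{lin}, \mathrm{lin}\langle\Sigma\rangle, \mathrm{poly}, \mathrm{poly}\langle\Sigma\rangle\}$ and let $\varphi \in \mathcal{L}^{*}_1$ be a formula over variables $X_1,\ldots,X_n$. Let $\mathcal{G}_n$ be the complete DAG over nodes $X_1,\ldots,X_n$ with edges $X_i \to X_j$ for all $1 \le i < j \le n$. Then $\varphi \in \mathrm{SAT}^{*}_{\mathcal{L}_1}$ if and only if $(\varphi,\mathcal{G}_n) \in \mathrm{SAT}^{*}_{\mathrm{DAG},\mathcal{L}_1}$.
   Context: All random variables share a fixed finite domain $\mathit{Val}=\{0,1,\ldots,c-1\}$. Syntax. Propositional events: $\mathbf p ::= X=x \mid \neg \mathbf p \mid \mathbf p\wedge\mathbf p$, where $X$ is a random variable and $x$ is a value (or a dummy variable bound by a summation operator). Terms of the probabilistic layer, with $\delta$ ranging over propositional events: base: $\mathbf t ::= \mathbb P(\delta)$; lin: $\mathbf t ::= \mathbb P(\delta)\mid \mathbf t+\mathbf t$; poly: $\mathbf t ::= \mathbb P(\delta)\mid \mathbf t+\mathbf t\mid -\mathbf t\mid \mathbf t\cdot\mathbf t$; the variants base$\langle\Sigma\rangle$, lin$\langle\Sigma\rangle$, poly$\langle\Sigma\rangle$ additionally allow $\sum_x \mathbf t$, where $x$ is a dummy variable and $\sum_x\mathbf t$ stands for $\mathbf t[0/x]+\mathbf t[1/x]+\cdots+\mathbf t[(c-1)/x]$. For each label $*$, $\mathcal L_1^*$ is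 the set of formulas $\mathbf f ::= \mathbf t\le \mathbf t' \mid \neg \mathbf f\mid \mathbf f\wedge\mathbf f$ with $\mathbf t,\mathbf t'$ terms of type $*$. Semantics. A formula over $X_1,\dots,X_n$ is evaluated in a joint probability distribution of $X_1,\ldots,X_n$ on $\mathit{Val}^n$ in the obvious way: $\mathbb P(\delta)$ is the probability of the event $\delta$, and arithmetic, $\le$, and Boolean connectives are interpreted as usual over the reals. Problems. $\mathrm{SAT}^*_{\mathcal L_1}$ is the set of formulas $\varphi\in\mathcal L_1^*$ that are satisfied by some joint distribution of their variables. $\mathrm{SAT}^*_{\mathrm{DAG},\mathcal L_1}$ is the set of pairs $(\varphi,\mathcal G)$, with $\varphi\in\mathcal L^*_1$ and $\mathcal G$ a DAG over the variables, such that $\varphi$ is true in some Bayesian network $\mathcal B=(\mathcal G,P_{\mathcal B})$ with graph $\mathcal G$, i.e. for some distribution $P_{\mathcal B}$ that factorizes over $\mathcal G$: $P_{\mathcal B}(x_1,\ldots,x_n)=\prod_{i=1}^n P_{\mathcal B}(x_i\mid \mathbf{pa}_i)$, where $\mathbf{pa}_i$ denotes the values of the parents of $X_i$ in $\mathcal G$, and the conditional probabilities are given by conditional probability tables. -}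

module Defs where

open import Algebra.Bundles.Raw using (RawRing)
import Algebra.Definitions.RawMonoid as RawMonoidDefs
import Algebra.Properties.Ring as RingProperties
open import Data.Bool.Base using (Bool; not; _∧_; if_then_else_)
open import Data.Fin.Base as Fin using (Fin)
import Data.Fin.Properties as Fin
open import Data.List.Base using (List; length; filter; allFin)
open import Data.Nat.Base as ℕ using (ℕ; zero; suc)
import Data.Nat.Properties as ℕ
open import Data.Product.Base using (Σ-syntax; ∃-syntax; _×_; _,_; proj₁; proj₂)
open import Data.Rational.Base as ℚ using (ℚ; 0ℚ; 1ℚ; ½; ∣_∣)
import Data.Rational.Properties as ℚ
open import Data.Rational.Solver using (module +-*-Solver)
open import Data.Vec.Base as Vec using (Vec; []; _∷_; lookup)
open import Data.Vec.Properties using (≡-dec)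
open import Level using (0ℓ)
open import Relation.Binary.Core using (Rel)
open import Relation.Binary.Construct.Closure.Transitive using (TransClosure; [_]; _∷_)
open import Relation.Binary.Definitions using (Decidable)
open import Relation.Binary.PropositionalEquality
  using (_≡_; refl; sym; trans; cong; cong₂; subst; module ≡-Reasoning)
open import Relation.Nullary.Decidable.Core using (does)
open import Relation.Nullary.Negation.Core using (¬_)

-- The reals are Cauchy sequences of rationals. They are not quotiented, so
-- equality of reals is _≈_ below (the difference tends to 0), never _≡_.

Eventually : (ℕ → Set) → Set
Eventually A = ∃[ N ] (∀ n → N ℕ.≤ n → A n)

IsCauchy : (ℕ → ℚ) → Set
IsCauchy s = ∀ ε → 0ℚ ℚ.< ε →
  ∃[ N ] (∀ m n → N ℕ.≤ m → N ℕ.≤ n → ∣ s m ℚ.- s n ∣ ℚ.≤ ε)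

module Cauchy where
  open +-*-Solver using (solve; _:=_; _:+_; :-_; _:-_)
  open RingProperties ℚ.+-*-ring using (x[y-z]≈xy-xz; [y-z]x≈yx-zx)

  IsBound : (ℕ → ℚ) → ℚ → Set
  IsBound s B = ℚ.Positive B × Eventually λ n → ∣ s n ∣ ℚ.≤ B

  const-cauchy : ∀ q → IsCauchy (λ _ → q)
  const-cauchy q ε 0<ε = 0 , λ _ _ _ _ →
    subst (ℚ._≤ ε) (sym (cong ∣_∣ (ℚ.+-inverseʳ q))) (ℚ.<⇒≤ 0<ε)

  half-pos : ∀ {ε} → 0ℚ ℚ.< ε → 0ℚ ℚ.< ½ ℚ.* ε
  half-pos {ε} 0<ε = ℚ.positive⁻¹ _ {{ℚ.pos*pos⇒pos ½ ε {{ℚ.positive 0<ε}}}}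

  halves : ∀ ε → ½ ℚ.* ε ℚ.+ ½ ℚ.* ε ≡ ε
  halves ε = trans (sym (ℚ.*-distribʳ-+ ε ½ ½)) (ℚ.*-identityˡ ε)

  +-cauchy : ∀ s t → IsCauchy s → IsCauchy t → IsCauchy (λ n → s n ℚ.+ t n)
  +-cauchy s t cs ct ε 0<ε = N₁ ℕ.⊔ N₂ , λ m n m≥ n≥ → begin
    ∣ (s m ℚ.+ t m) ℚ.- (s n ℚ.+ t n) ∣
      ≡⟨ cong ∣_∣ (solve 4 (λ a b c d →
           (a :+ b) :- (c :+ d) := (a :- c) :+ (b :- d)) refl (s m) (t m) (s n) (t n)) ⟩
    ∣ (s m ℚ.- s n) ℚ.+ (t m ℚ.- t n) ∣
      ≤⟨ ℚ.∣p+q∣≤∣p∣+∣q∣ (s m ℚ.- s n) (t m ℚ.- t n) ⟩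
    ∣ s m ℚ.- s n ∣ ℚ.+ ∣ t m ℚ.- t n ∣
      ≤⟨ ℚ.+-mono-≤ (proj₂ c₁ m n (ℕ.m⊔n≤o⇒m≤o N₁ N₂ m≥) (ℕ.m⊔n≤o⇒m≤o N₁ N₂ n≥))
                    (proj₂ c₂ m n (ℕ.m⊔n≤o⇒n≤o N₁ N₂ m≥) (ℕ.m⊔n≤o⇒n≤o N₁ N₂ n≥)) ⟩
    ½ ℚ.* ε ℚ.+ ½ ℚ.* ε
      ≡⟨ halves ε ⟩
    ε ∎
    where
    open ℚ.≤-Reasoning
    c₁ = cs (½ ℚ.* ε) (half-pos 0<ε)
    c₂ = ct (½ ℚ.* ε) (half-pos 0<ε)
    N₁ = proj₁ c₁
    N₂ = proj₁ c₂

  neg-cauchy : ∀ s → IsCauchy s → IsCauchy (λ n → ℚ.- s n)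
  neg-cauchy s cs ε 0<ε = proj₁ (cs ε 0<ε) , λ m n m≥ n≥ →
    subst (ℚ._≤ ε)
      (trans (sym (ℚ.∣-p∣≡∣p∣ (s m ℚ.- s n)))
             (cong ∣_∣ (solve 2 (λ a b → :- (a :- b) := (:- a) :- (:- b)) refl (s m) (s n))))
      (proj₂ (cs ε 0<ε) m n m≥ n≥)

  bound : ∀ s → IsCauchy s → ∃[ B ] IsBound s B
  bound s cs with cs 1ℚ (ℚ.positive⁻¹ 1ℚ)
  ... | N , close = 1ℚ ℚ.+ ∣ s N ∣ , ℚ.pos+nonNeg⇒pos 1ℚ ∣ s N ∣ {{ℚ.∣-∣-nonNeg (s N)}} , N , λ n n≥ → begin
    ∣ s n ∣
      ≡⟨ cong ∣_∣ (solve 2 (λ a b → a := (a :- b) :+ b) refl (s n) (s N)) ⟩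
    ∣ (s n ℚ.- s N) ℚ.+ s N ∣
      ≤⟨ ℚ.∣p+q∣≤∣p∣+∣q∣ (s n ℚ.- s N) (s N) ⟩
    ∣ s n ℚ.- s N ∣ ℚ.+ ∣ s N ∣
      ≤⟨ ℚ.+-monoˡ-≤ ∣ s N ∣ (close n N n≥ ℕ.≤-refl) ⟩
    1ℚ ℚ.+ ∣ s N ∣ ∎
    where open ℚ.≤-Reasoning

  ∣*∣-mono : ∀ p q B δ → ℚ.Positive B → ∣ p ∣ ℚ.≤ B → ∣ q ∣ ℚ.≤ δ → ∣ p ℚ.* q ∣ ℚ.≤ B ℚ.* δ
  ∣*∣-mono p q B δ posB p≤B q≤δ = begin
    ∣ p ℚ.* q ∣      ≡⟨ ℚ.∣p*q∣≡∣p∣*∣q∣ p q ⟩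
    ∣ p ∣ ℚ.* ∣ q ∣  ≤⟨ ℚ.*-monoʳ-≤-nonNeg ∣ q ∣ {{ℚ.∣-∣-nonNeg q}} p≤B ⟩
    B ℚ.* ∣ q ∣      ≤⟨ ℚ.*-monoˡ-≤-nonNeg B {{ℚ.pos⇒nonNeg B {{posB}}}} q≤δ ⟩
    B ℚ.* δ          ∎
    where open ℚ.≤-Reasoning

  insert-difference : ∀ x y z → x ℚ.- y ≡ (x ℚ.- z) ℚ.+ (z ℚ.- y)
  insert-difference = solve 3 (λ x y z → x :- y := (x :- z) :+ (z :- y)) refl

  *-split : ∀ a b c d → a ℚ.* b ℚ.- c ℚ.* d ≡ a ℚ.* (b ℚ.- d) ℚ.+ d ℚ.* (a ℚ.- c)
  *-split a b c d = begin
    a ℚ.* b ℚ.- c ℚ.* d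
      ≡⟨ insert-difference (a ℚ.* b) (c ℚ.* d) (a ℚ.* d) ⟩
    (a ℚ.* b ℚ.- a ℚ.* d) ℚ.+ (a ℚ.* d ℚ.- c ℚ.* d)
      ≡⟨ cong₂ ℚ._+_ (x[y-z]≈xy-xz a b d)
           (trans (ℚ.*-comm d (a ℚ.- c)) ([y-z]x≈yx-zx d a c)) ⟨
    a ℚ.* (b ℚ.- d) ℚ.+ d ℚ.* (a ℚ.- c) ∎
    where open ≡-Reasoning

  share : ∀ B ε → ℚ.Positive B → 0ℚ ℚ.< ε → ∃[ δ ] (0ℚ ℚ.< δ × B ℚ.* δ ≡ ε)
  share B ε posB 0<ε = ℚ.1/ B ℚ.* ε ,
    ℚ.positive⁻¹ _ {{ℚ.pos*pos⇒pos (ℚ.1/ B) {{ℚ.1/pos⇒pos B}} ε {{ℚ.positive 0<ε}}}} ,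
    trans (sym (ℚ.*-assoc B (ℚ.1/ B) ε))
          (trans (cong (ℚ._* ε) (ℚ.*-inverseʳ B)) (ℚ.*-identityˡ ε))
    where
    instance
      positive-B : ℚ.Positive B
      positive-B = posB
      nonZero-B : ℚ.NonZero B
      nonZero-B = ℚ.pos⇒nonZero B

  *-close : ∀ a b c d B₁ B₂ δ ε → ℚ.Positive B₁ → ℚ.Positive B₂ → (B₁ ℚ.+ B₂) ℚ.* δ ≡ ε →
    ∣ a ∣ ℚ.≤ B₁ → ∣ d ∣ ℚ.≤ B₂ → ∣ a ℚ.- c ∣ ℚ.≤ δ → ∣ b ℚ.- d ∣ ℚ.≤ δ →
    ∣ a ℚ.* b ℚ.- c ℚ.* d ∣ ℚ.≤ ε
  *-close a b c d B₁ B₂ δ ε pos₁ pos₂ Bδ≡ε a≤ d≤ ac≤ bd≤ = begin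
    ∣ a ℚ.* b ℚ.- c ℚ.* d ∣
      ≡⟨ cong ∣_∣ (*-split a b c d) ⟩
    ∣ a ℚ.* (b ℚ.- d) ℚ.+ d ℚ.* (a ℚ.- c) ∣
      ≤⟨ ℚ.∣p+q∣≤∣p∣+∣q∣ (a ℚ.* (b ℚ.- d)) (d ℚ.* (a ℚ.- c)) ⟩
    ∣ a ℚ.* (b ℚ.- d) ∣ ℚ.+ ∣ d ℚ.* (a ℚ.- c) ∣
      ≤⟨ ℚ.+-mono-≤ (∣*∣-mono a (b ℚ.- d) B₁ δ pos₁ a≤ bd≤)
                    (∣*∣-mono d (a ℚ.- c) B₂ δ pos₂ d≤ ac≤) ⟩
    B₁ ℚ.* δ ℚ.+ B₂ ℚ.* δ
      ≡⟨ ℚ.*-distribʳ-+ δ B₁ B₂ ⟨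
    (B₁ ℚ.+ B₂) ℚ.* δ
      ≡⟨ Bδ≡ε ⟩
    ε ∎
    where open ℚ.≤-Reasoning

  *-cauchy : ∀ s t → IsCauchy s → IsCauchy t → IsCauchy (λ n → s n ℚ.* t n)
  *-cauchy s t cs ct ε 0<ε =
    let B₁ , pos₁ , M₁ , s≤ = bound s cs
        B₂ , pos₂ , M₂ , t≤ = bound t ct
        δ , 0<δ , Bδ≡ε = share (B₁ ℚ.+ B₂) ε (ℚ.pos+pos⇒pos B₁ {{pos₁}} B₂ {{pos₂}}) 0<ε
        K₁ , c₁ = cs δ 0<δ
        K₂ , c₂ = ct δ 0<δ
    in (M₁ ℕ.⊔ M₂) ℕ.⊔ (K₁ ℕ.⊔ K₂) , λ m n m≥ n≥ →
       let M≤m = ℕ.m⊔n≤o⇒m≤o (M₁ ℕ.⊔ M₂) (K₁ ℕ.⊔ K₂) m≥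
           M≤n = ℕ.m⊔n≤o⇒m≤o (M₁ ℕ.⊔ M₂) (K₁ ℕ.⊔ K₂) n≥
           K≤m = ℕ.m⊔n≤o⇒n≤o (M₁ ℕ.⊔ M₂) (K₁ ℕ.⊔ K₂) m≥
           K≤n = ℕ.m⊔n≤o⇒n≤o (M₁ ℕ.⊔ M₂) (K₁ ℕ.⊔ K₂) n≥
       in *-close (s m) (t m) (s n) (t n) B₁ B₂ δ ε pos₁ pos₂ Bδ≡ε
            (s≤ m (ℕ.m⊔n≤o⇒m≤o M₁ M₂ M≤m)) (t≤ n (ℕ.m⊔n≤o⇒n≤o M₁ M₂ M≤n))
            (c₁ m n (ℕ.m⊔n≤o⇒m≤o K₁ K₂ K≤m) (ℕ.m⊔n≤o⇒m≤o K₁ K₂ K≤n))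
            (c₂ m n (ℕ.m⊔n≤o⇒n≤o K₁ K₂ K≤m) (ℕ.m⊔n≤o⇒n≤o K₁ K₂ K≤n))

record ℝ : Set where
  constructor mkℝ
  field
    seq    : ℕ → ℚ
    cauchy : IsCauchy seq

open ℝ public

infix  4 _≈_ _≤_
infixl 6 _+_
infixl 7 _*_
infix  8 -_

_≈_ : Rel ℝ 0ℓ
x ≈ y = ∀ ε → 0ℚ ℚ.< ε → Eventually λ n → ∣ seq x n ℚ.- seq y n ∣ ℚ.≤ ε

_≤_ : Rel ℝ 0ℓ
x ≤ y = ∀ ε → 0ℚ ℚ.< ε → Eventually λ n → seq x n ℚ.≤ seq y n ℚ.+ ε

-- Defined by copatterns so that the Cauchy proofs do not unfold.

fromℚ : ℚ → ℝ
seq    (fromℚ q) _ = q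
cauchy (fromℚ q)   = Cauchy.const-cauchy q

0ℝ 1ℝ : ℝ
0ℝ = fromℚ 0ℚ
1ℝ = fromℚ 1ℚ

_+_ _*_ : ℝ → ℝ → ℝ
seq    (x + y) n = seq x n ℚ.+ seq y n
cauchy (x + y)   = Cauchy.+-cauchy (seq x) (seq y) (cauchy x) (cauchy y)
seq    (x * y) n = seq x n ℚ.* seq y n
cauchy (x * y)   = Cauchy.*-cauchy (seq x) (seq y) (cauchy x) (cauchy y)

-_ : ℝ → ℝ
seq    (- x) n = ℚ.- seq x n
cauchy (- x)   = Cauchy.neg-cauchy (seq x) (cauchy x)

ℝ-rawRing : RawRing 0ℓ 0ℓ
ℝ-rawRing = record
  { Carrier = ℝ ; _≈_ = _≈_ ; _+_ = _+_ ; _*_ = _*_ ; -_ = -_ ; 0# = 0ℝ ; 1# = 1ℝ }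

open RawMonoidDefs (RawRing.+-rawMonoid ℝ-rawRing) public using (sum)
open RawMonoidDefs (RawRing.*-rawMonoid ℝ-rawRing) public using ()
  renaming (sum to product)

-- Throughout, c is the size of the common domain, n the number of random
-- variables, and k the number of dummy variables in scope, which are
-- represented by de Bruijn indices.

Val : ℕ → Set
Val c = Fin c

data Value (c k : ℕ) : Set where
  val   : Val c → Value c k
  dummy : Fin k → Value c k

infix  7 _≐_
infixr 6 _∧ᵉ_

data Event (c n k : ℕ) : Set where
  _≐_  : Fin n → Value c k → Event c n k
  ¬ᵉ_  : Event c n k → Event c n k
  _∧ᵉ_ : Event c n k → Event c n k → Event c n k

data Label : Set where
  base base⟨Σ⟩ lin lin⟨Σ⟩ poly poly⟨Σ⟩ : Label

data HasSum : Label → Set where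
  base⟨Σ⟩ : HasSum base⟨Σ⟩
  lin⟨Σ⟩  : HasSum lin⟨Σ⟩
  poly⟨Σ⟩ : HasSum poly⟨Σ⟩

data HasAdd : Label → Set where
  lin     : HasAdd lin
  lin⟨Σ⟩  : HasAdd lin⟨Σ⟩
  poly    : HasAdd poly
  poly⟨Σ⟩ : HasAdd poly⟨Σ⟩

data HasNegMul : Label → Set where
  poly    : HasNegMul poly
  poly⟨Σ⟩ : HasNegMul poly⟨Σ⟩

data Term (l : Label) (c n : ℕ) : (k : ℕ) → Set where
  ℙ    : ∀ {k} → Event c n k → Term l c n k
  plus : ∀ {k} → HasAdd l → Term l c n k → Term l c n k → Term l c n k
  neg  : ∀ {k} → HasNegMul l → Term l c n k → Term l c n k
  mult : ∀ {k} → HasNegMul l → Term l c n k → Term l c n k → Term l c n k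
  sumₓ : ∀ {k} → HasSum l → Term l c n (suc k) → Term l c n k

infix  7 _≤ᶠ_
infixr 6 _∧ᶠ_

data Formula (l : Label) (c n : ℕ) : Set where
  _≤ᶠ_ : Term l c n 0 → Term l c n 0 → Formula l c n
  ¬ᶠ_  : Formula l c n → Formula l c n
  _∧ᶠ_ : Formula l c n → Formula l c n → Formula l c n

Assignment : ℕ → ℕ → Set
Assignment c n = Vec (Val c) n

sumAll : ∀ {c n} → (Assignment c n → ℝ) → ℝ
sumAll {n = zero}  f = f []
sumAll {n = suc n} f = sum λ v → sumAll λ x → f (v ∷ x)

record IsDistribution {A : Set} (∑ : (A → ℝ) → ℝ) (p : A → ℝ) : Set where
  field
    nonneg : ∀ a → 0ℝ ≤ p a
    total  : ∑ p ≈ 1ℝ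

record Distribution (c n : ℕ) : Set where
  field
    mass           : Assignment c n → ℝ
    isDistribution : IsDistribution sumAll mass

open Distribution public

Pr : ∀ {c n} → Distribution c n → (Assignment c n → Bool) → ℝ
Pr P E = sumAll λ x → if E x then mass P x else 0ℝ

-- Dummy variables are interpreted by an environment ρ, so that
-- ⟦ sumₓ _ t ⟧ᵗ is the sum over all v of the value of t[v/x].

⟦_⟧ᵛ : ∀ {c k} → Value c k → Vec (Val c) k → Val c
⟦ val v ⟧ᵛ   ρ = v
⟦ dummy j ⟧ᵛ ρ = lookup ρ j

⟦_⟧ᵉ : ∀ {c n k} → Event c n k → Vec (Val c) k → Assignment c n → Bool
⟦ i ≐ v ⟧ᵉ  ρ x = does (lookup x i Fin.≟ ⟦ v ⟧ᵛ ρ)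
⟦ ¬ᵉ e ⟧ᵉ   ρ x = not (⟦ e ⟧ᵉ ρ x)
⟦ d ∧ᵉ e ⟧ᵉ ρ x = ⟦ d ⟧ᵉ ρ x ∧ ⟦ e ⟧ᵉ ρ x

⟦_⟧ᵗ : ∀ {l c n k} → Term l c n k → Distribution c n → Vec (Val c) k → ℝ
⟦ ℙ e ⟧ᵗ        P ρ = Pr P (⟦ e ⟧ᵉ ρ)
⟦ plus _ t u ⟧ᵗ P ρ = ⟦ t ⟧ᵗ P ρ + ⟦ u ⟧ᵗ P ρ
⟦ neg _ t ⟧ᵗ    P ρ = - ⟦ t ⟧ᵗ P ρ
⟦ mult _ t u ⟧ᵗ P ρ = ⟦ t ⟧ᵗ P ρ * ⟦ u ⟧ᵗ P ρ
⟦ sumₓ _ t ⟧ᵗ   P ρ = sum λ v → ⟦ t ⟧ᵗ P (v ∷ ρ)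

infix 4 _⊨_

_⊨_ : ∀ {l c n} → Distribution c n → Formula l c n → Set
P ⊨ t ≤ᶠ u = ⟦ t ⟧ᵗ P [] ≤ ⟦ u ⟧ᵗ P []
P ⊨ ¬ᶠ φ   = ¬ (P ⊨ φ)
P ⊨ φ ∧ᶠ ψ = (P ⊨ φ) × (P ⊨ ψ)

record DAG (n : ℕ) : Set₁ where
  field
    _⟶_     : Rel (Fin n) 0ℓ
    _⟶?_    : Decidable _⟶_
    acyclic : ∀ {i} → ¬ TransClosure _⟶_ i i

  parents : Fin n → List (Fin n)
  parents i = filter (_⟶? i) (allFin n)

  ParentValues : ℕ → Fin n → Set
  ParentValues c i = Vec (Val c) (length (parents i))

  parentValues : ∀ {c} (i : Fin n) → Assignment c n → ParentValues c i
  parentValues i x = Vec.map (lookup x) (Vec.fromList (parents i))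

  hasParentValues : ∀ {c} (i : Fin n) → ParentValues c i → Assignment c n → Bool
  hasParentValues i pa x = does (≡-dec Fin._≟_ (parentValues i x) pa)

record BayesianNetwork (c : ℕ) {n : ℕ} (G : DAG n) : Set where
  open DAG G
  field
    joint : Distribution c n
    cpt   : (i : Fin n) → ParentValues c i → Val c → ℝ

    cpt-isDistribution : ∀ i pa → IsDistribution sum (cpt i pa)

    -- cpt i pa v is P(Xᵢ = v ∣ paᵢ); in multiplied-out form, since P(paᵢ)
    -- may vanish, in which case the row is an arbitrary distribution.
    cpt-conditional : ∀ i pa v →
      cpt i pa v * Pr joint (hasParentValues i pa)
        ≈ Pr joint (λ x → does (lookup x i Fin.≟ v) ∧ hasParentValues i pa x)

    factorizes : ∀ x →
      mass joint x ≈ product (λ i → cpt i (parentValues i x) (lookup x i))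

open BayesianNetwork public using (joint)

completeDAG : ∀ n → DAG n
completeDAG n = record
  { _⟶_ = Fin._<_ ; _⟶?_ = Fin._<?_ ; acyclic = λ p → Fin.<-irrefl refl (collapse p) }
  where
  collapse : ∀ {i j : Fin n} → TransClosure Fin._<_ i j → i Fin.< j
  collapse [ i<j ]     = i<j
  collapse (i<j ∷ j<k) = ℕ.<-trans i<j (collapse j<k)

SAT : ∀ {l c n} → Formula l c n → Set
SAT {c = c} {n} φ = Σ[ P ∈ Distribution c n ] (P ⊨ φ)

SAT-DAG : ∀ {l c n} → Formula l c n → DAG n → Set
SAT-DAG {c = c} φ G = Σ[ B ∈ BayesianNetwork c G ] (joint B ⊨ φ)

{-# OPTIONS --safe #-}

-- Any joint distribution P factorizes over the complete DAG by the chain rule.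
-- The conditional probability tables are quotients of probabilities, and rows
-- for parent values of probability zero are filled with a marginal. For an
-- assignment x let Q k be the probability of agreeing with x on the first k
-- variables. The parents of Xᵢ are its predecessors, so P(xᵢ ∣ paᵢ) · Q i ≈ Q (i+1)
-- even where Q i vanishes, and the product of the table entries telescopes
-- from Q 0 ≈ 1 to Q n ≈ P(x).

module Submission where

open import Algebra.Bundles using (CommutativeSemiring)
import Algebra.Definitions.RawMonoid as RawMonoidDefs
import Algebra.Properties.CommutativeSemigroup as CommutativeSemigroupProperties
import Algebra.Properties.Semiring.Sum as SemiringSum
open import Algebra.Structures.Biased using (IsCommutativeSemiringˡ)
open import Axiom.ExcludedMiddle using (ExcludedMiddle)
open import Data.Bool.Base using (Bool; true; false; _∧_; if_then_else_)
open import Data.Fin.Base as Fin using (Fin; toℕ)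
import Data.Fin.Properties as Fin
import Data.Integer.Base as ℤ
open import Data.List.Base as List using (List)
open import Data.List.Membership.Propositional using (_∈_)
open import Data.List.Membership.Propositional.Properties using (∈-filter⁺; ∈-filter⁻; ∈-allFin)
open import Data.List.Relation.Unary.Any using (here; there)
open import Data.Nat.Base as ℕ using (ℕ; zero; suc)
import Data.Nat.Properties as ℕ
open import Data.Product.Base using (∃-syntax; _×_; _,_; proj₂)
open import Data.Product.Function.NonDependent.Propositional using (_×-⇔_)
open import Data.Rational.Base as ℚ using (ℚ; 0ℚ; 1ℚ; ½; ∣_∣)
import Data.Rational.Properties as ℚ
open import Data.Rational.Solver using (module +-*-Solver)
open import Data.Sum.Base using (inj₁; inj₂)
open import Data.Vec.Base as Vec using (Vec; []; _∷_; lookup)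
import Data.Vec.Properties as Vec
open import Data.Vec.Relation.Binary.Pointwise.Extensional as Pointwise using (Pointwise-≡⇒≡)
open import Function.Base using (_∘_; case_of_)
open import Function.Bundles using (_⇔_; mk⇔; Equivalence)
open import Function.Construct.Composition using (_⇔-∘_)
open import Function.Construct.Identity using (⇔-id)
open import Level using (0ℓ)
open import Relation.Binary.PropositionalEquality
  using (_≡_; _≢_; refl; sym; trans; cong; cong₂; subst; subst₂; module ≡-Reasoning)
import Relation.Binary.Reasoning.Setoid as SetoidReasoning
open import Relation.Binary.Structures using (IsEquivalence)
open import Relation.Nullary.Decidable
  using (Dec; yes; no; does; _→-dec_; _×-dec_; does-⇔; dec-false; dec-true)
open import Relation.Nullary.Negation using (¬_; contradiction)

-- Finite sums and products in a commutative semiring.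

-- Sums and products of reals are handled through an abstract semiring: on
-- x + y and x * y in ℝ themselves, conversion checking unfolds the Cauchy proofs.
module SemiringSums {a ℓ} (R : CommutativeSemiring a ℓ) where
  open CommutativeSemiring R
    using (Carrier; _≈_; _+_; _*_; 0#; 1#; +-cong; +-congˡ; +-identityˡ; +-identityʳ;
           *-assoc; *-comm; *-congˡ; *-congʳ; *-identityˡ; *-identityʳ; zeroʳ)
  open CommutativeSemiring R using (semiring; setoid; *-rawMonoid; *-commutativeSemigroup)
    renaming (sym to ≈-sym; trans to ≈-trans)
  open CommutativeSemigroupProperties *-commutativeSemigroup using (xy∙z≈y∙xz)
  open SemiringSum semiring public
    using (sum; sum-cong-≋; sum-replicate-zero; ∑-comm; *-distribʳ-sum)
  open RawMonoidDefs *-rawMonoid using () renaming (sum to product)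
  open SetoidReasoning setoid

  sum-single : ∀ {n} (f : Fin n → Carrier) i → (∀ j → j ≢ i → f j ≈ 0#) → sum f ≈ f i
  sum-single {suc n} f Fin.zero f≈0 = begin
    f Fin.zero + sum (f ∘ Fin.suc)      ≈⟨ +-congˡ (sum-cong-≋ λ j → f≈0 (Fin.suc j) λ ()) ⟩
    f Fin.zero + sum {n} (λ _ → 0#)     ≈⟨ +-congˡ (sum-replicate-zero n) ⟩
    f Fin.zero + 0#                     ≈⟨ +-identityʳ (f Fin.zero) ⟩
    f Fin.zero                          ∎
  sum-single f (Fin.suc i) f≈0 = begin
    f Fin.zero + sum (f ∘ Fin.suc)
      ≈⟨ +-cong (f≈0 Fin.zero λ ())
           (sum-single (f ∘ Fin.suc) i λ j j≢i → f≈0 (Fin.suc j) (j≢i ∘ Fin.suc-injective)) ⟩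
    0# + f (Fin.suc i)
      ≈⟨ +-identityˡ (f (Fin.suc i)) ⟩
    f (Fin.suc i) ∎

  -- The relation is a parameter because the abstract semiring carries no order; it is instantiated
  -- with `_≲_`.
  sum-mono : ∀ {ℓ′} (_∼_ : Carrier → Carrier → Set ℓ′) → 0# ∼ 0# →
    (∀ {x x′ y y′} → x ∼ x′ → y ∼ y′ → (x + y) ∼ (x′ + y′)) →
    ∀ {n} {f g : Fin n → Carrier} → (∀ i → f i ∼ g i) → sum f ∼ sum g
  sum-mono _∼_ 0∼0 +-mono {zero}  f∼g = 0∼0
  sum-mono _∼_ 0∼0 +-mono {suc n} f∼g =
    +-mono (f∼g Fin.zero) (sum-mono _∼_ 0∼0 +-mono (f∼g ∘ Fin.suc))

  -- Each step is multiplied out, so no `q k` has to be invertible. The head factor turns `q 0` into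
  -- `q 1`, and the induction proceeds with the shifted sequence `q ∘ suc`.
  product-telescope : ∀ n (a : Fin n → Carrier) (q : ℕ → Carrier) →
    (∀ i → a i * q (toℕ i) ≈ q (suc (toℕ i))) → product a * q 0 ≈ q n
  product-telescope zero    a q step = *-identityˡ (q 0)
  product-telescope (suc n) a q step = begin
    (a Fin.zero * product (a ∘ Fin.suc)) * q 0
      ≈⟨ xy∙z≈y∙xz (a Fin.zero) (product (a ∘ Fin.suc)) (q 0) ⟩
    product (a ∘ Fin.suc) * (a Fin.zero * q 0)
      ≈⟨ *-congˡ (step Fin.zero) ⟩
    product (a ∘ Fin.suc) * q 1
      ≈⟨ product-telescope n (a ∘ Fin.suc) (q ∘ suc) (step ∘ Fin.suc) ⟩
    q (suc n) ∎

  product-chain : ∀ {n} (a p : Fin n → Carrier) (q : ℕ → Carrier) → q 0 ≈ 1# →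
    (∀ i → p i ≈ q (toℕ i)) → (∀ i → a i * p i ≈ q (suc (toℕ i))) → product a ≈ q n
  product-chain {n} a p q q₀≈1 p≈q step = begin
    product a         ≈⟨ *-identityʳ (product a) ⟨
    product a * 1#    ≈⟨ *-congˡ q₀≈1 ⟨
    product a * q 0   ≈⟨ product-telescope n a q (λ i →
                         ≈-trans (*-congˡ (≈-sym (p≈q i))) (step i)) ⟩
    q n               ∎

  -- Division of the weights `f` by their total `p`, with `y` the inverse of `p`. `N` stands for
  -- nonnegativity, which the semiring cannot express.
  normalize : ∀ {n ℓ′} (N : Carrier → Set ℓ′) (f : Fin n → Carrier) p y →
    sum f ≈ p → p * y ≈ 1# → (∀ z → N z → N (z * y)) → (∀ i → N (f i)) →
    ∃[ g ] ((∀ i → N (g i)) × sum g ≈ 1# × (∀ i → g i * p ≈ f i))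
  normalize N f p y ∑f≈p py≈1 N-* Nf = (λ i → f i * y) , (λ i → N-* (f i) (Nf i)) ,
    (begin
      sum (λ i → f i * y)   ≈⟨ *-distribʳ-sum y f ⟨
      sum f * y             ≈⟨ *-congʳ ∑f≈p ⟩
      p * y                 ≈⟨ py≈1 ⟩
      1#                    ∎) ,
    λ i → begin
      (f i * y) * p         ≈⟨ *-assoc (f i) y p ⟩
      f i * (y * p)         ≈⟨ *-congˡ (≈-trans (*-comm y p) py≈1) ⟩
      f i * 1#              ≈⟨ *-identityʳ (f i) ⟩
      f i                   ∎

  *-null : ∀ x y z → y ≈ 0# → z ≈ 0# → x * y ≈ z
  *-null x y z y≈0 z≈0 = begin
    x * y    ≈⟨ *-congˡ y≈0 ⟩
    x * 0#   ≈⟨ zeroʳ x ⟩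
    0#       ≈⟨ z≈0 ⟨
    z        ∎

open import Defs

-- Order, equality and arithmetic of Cauchy reals.

eventually-map₂ : {A B C : ℕ → Set} → (∀ n → A n → B n → C n) →
  Eventually A → Eventually B → Eventually C
eventually-map₂ f (M , a) (N , b) = M ℕ.⊔ N , λ n n≥ →
  f n (a n (ℕ.m⊔n≤o⇒m≤o M N n≥)) (b n (ℕ.m⊔n≤o⇒n≤o M N n≥))

eventually-map : {A B : ℕ → Set} → (∀ n → A n → B n) → Eventually A → Eventually B
eventually-map f (N , a) = N , λ n n≥ → f n (a n n≥)

p≤∣p∣ : ∀ p → p ℚ.≤ ∣ p ∣
p≤∣p∣ p with ℚ.≤-total 0ℚ p
... | inj₁ 0≤p = ℚ.≤-reflexive (sym (ℚ.0≤p⇒∣p∣≡p 0≤p))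
... | inj₂ p≤0 = ℚ.≤-trans p≤0 (ℚ.0≤∣p∣ p)

∣p-q∣≤r⇒p≤q+r : ∀ p q {r} → ∣ p ℚ.- q ∣ ℚ.≤ r → p ℚ.≤ q ℚ.+ r
∣p-q∣≤r⇒p≤q+r p q {r} ∣p-q∣≤r = begin
  p                ≡⟨ solve 2 (λ p q → p := q :+ (p :- q)) refl p q ⟩
  q ℚ.+ (p ℚ.- q)  ≤⟨ ℚ.+-monoʳ-≤ q (ℚ.≤-trans (p≤∣p∣ _) ∣p-q∣≤r) ⟩
  q ℚ.+ r          ∎
  where
  open ℚ.≤-Reasoning
  open +-*-Solver

p≤q+r⇒p-q≤r : ∀ p q {r} → p ℚ.≤ q ℚ.+ r → p ℚ.- q ℚ.≤ r
p≤q+r⇒p-q≤r p q {r} p≤q+r = begin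
  p ℚ.- q          ≤⟨ ℚ.+-monoˡ-≤ (ℚ.- q) p≤q+r ⟩
  q ℚ.+ r ℚ.- q    ≡⟨ solve 2 (λ q r → q :+ r :- q := r) refl q r ⟩
  r                ∎
  where
  open ℚ.≤-Reasoning
  open +-*-Solver

∣p-q∣≤r : ∀ p q {r} → p ℚ.≤ q ℚ.+ r → q ℚ.≤ p ℚ.+ r → ∣ p ℚ.- q ∣ ℚ.≤ r
∣p-q∣≤r p q {r} p≤q+r q≤p+r with ℚ.∣p∣≡p∨∣p∣≡-p (p ℚ.- q)
... | inj₁ eq = subst (ℚ._≤ r) (sym eq) (p≤q+r⇒p-q≤r p q p≤q+r)
... | inj₂ eq = subst (ℚ._≤ r)
  (trans (solve 2 (λ p q → q :- p := :- (p :- q)) refl p q) (sym eq)) (p≤q+r⇒p-q≤r q p q≤p+r)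
  where open +-*-Solver

-- _≈_ and _≤_ unfold to statements about the underlying sequences, from which
-- unification cannot recover x and y; wrapping them in records prevents this.

infix 4 _≃_ _≲_

record _≃_ (x y : ℝ) : Set where
  constructor ≈⇒≃
  field ≃⇒≈ : x ≈ y

record _≲_ (x y : ℝ) : Set where
  constructor ≤⇒≲
  field ≲⇒≤ : x ≤ y

open _≃_
open _≲_

≲-reflexive : ∀ {x y} → x ≃ y → x ≲ y
≲-reflexive (≈⇒≃ x≈y) = ≤⇒≲ λ ε 0<ε → eventually-map (λ _ → ∣p-q∣≤r⇒p≤q+r _ _) (x≈y ε 0<ε)

≲-antisym : ∀ {x y} → x ≲ y → y ≲ x → x ≃ y
≲-antisym (≤⇒≲ x≤y) (≤⇒≲ y≤x) = ≈⇒≃ λ ε 0<ε →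
  eventually-map₂ (λ _ → ∣p-q∣≤r _ _) (x≤y ε 0<ε) (y≤x ε 0<ε)

≲-trans : ∀ {x y z} → x ≲ y → y ≲ z → x ≲ z
≲-trans {z = z} (≤⇒≲ x≤y) (≤⇒≲ y≤z) = ≤⇒≲ λ ε 0<ε → eventually-map₂
  (λ n x≤ y≤ → ℚ.≤-trans x≤ (ℚ.≤-trans (ℚ.+-monoˡ-≤ (½ ℚ.* ε) y≤) (ℚ.≤-reflexive
    (trans (ℚ.+-assoc (seq z n) (½ ℚ.* ε) (½ ℚ.* ε)) (cong (seq z n ℚ.+_) (Cauchy.halves ε))))))
  (x≤y _ (Cauchy.half-pos 0<ε)) (y≤z _ (Cauchy.half-pos 0<ε))

+-mono-≲ : ∀ {x x′ y y′} → x ≲ x′ → y ≲ y′ → x + y ≲ x′ + y′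
+-mono-≲ {x′ = x′} {y′ = y′} (≤⇒≲ x≤x′) (≤⇒≲ y≤y′) = ≤⇒≲ λ ε 0<ε → eventually-map₂
  (λ n x≤ y≤ → ℚ.≤-trans (ℚ.+-mono-≤ x≤ y≤) (ℚ.≤-reflexive
    (trans (solve 3 (λ a b e → (a :+ e) :+ (b :+ e) := (a :+ b) :+ (e :+ e)) refl
             (seq x′ n) (seq y′ n) (½ ℚ.* ε))
           (cong (seq x′ n ℚ.+ seq y′ n ℚ.+_) (Cauchy.halves ε)))))
  (x≤x′ _ (Cauchy.half-pos 0<ε)) (y≤y′ _ (Cauchy.half-pos 0<ε))
  where open +-*-Solver

-- Transfers the semiring laws, which hold term by term in the rationals.
≃-pointwise : ∀ {x y} → (∀ n → seq x n ≡ seq y n) → x ≃ y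
≃-pointwise {x} {y} x≗y = ≈⇒≃ λ ε 0<ε → 0 , λ n _ → subst (ℚ._≤ ε)
  (sym (cong ∣_∣ (trans (cong (ℚ._- seq y n) (x≗y n)) (ℚ.+-inverseʳ (seq y n))))) (ℚ.<⇒≤ 0<ε)

≃-refl : ∀ {x} → x ≃ x
≃-refl = ≃-pointwise λ _ → refl

≃-sym : ∀ {x y} → x ≃ y → y ≃ x
≃-sym {x} {y} (≈⇒≃ x≈y) = ≈⇒≃ λ ε 0<ε → eventually-map
  (λ n → subst (ℚ._≤ ε) (trans (sym (ℚ.∣-p∣≡∣p∣ (seq x n ℚ.- seq y n)))
    (cong ∣_∣ (solve 2 (λ p q → :- (p :- q) := q :- p) refl (seq x n) (seq y n)))))
  (x≈y ε 0<ε)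
  where open +-*-Solver

-- Passing through the order reuses the halving of `ε` in `≲-trans`.
≃-trans : ∀ {x y z} → x ≃ y → y ≃ z → x ≃ z
≃-trans x≃y y≃z = ≲-antisym
  (≲-trans (≲-reflexive x≃y) (≲-reflexive y≃z))
  (≲-trans (≲-reflexive (≃-sym y≃z)) (≲-reflexive (≃-sym x≃y)))

+-cong-≃ : ∀ {x x′ y y′} → x ≃ x′ → y ≃ y′ → x + y ≃ x′ + y′
+-cong-≃ x≃x′ y≃y′ = ≲-antisym
  (+-mono-≲ (≲-reflexive x≃x′) (≲-reflexive y≃y′))
  (+-mono-≲ (≲-reflexive (≃-sym x≃x′)) (≲-reflexive (≃-sym y≃y′)))

-- Since `x * y - x′ * y′` equals `x * (y - y′) + y′ * (x - x′)`, bounds on `x` and `y′` suffice,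
-- with `δ` chosen as ε / (B₁ + B₂).
*-cong-≃ : ∀ {x x′ y y′} → x ≃ x′ → y ≃ y′ → x * y ≃ x′ * y′
*-cong-≃ {x} {x′} {y} {y′} (≈⇒≃ x≈x′) (≈⇒≃ y≈y′) = ≈⇒≃ λ ε 0<ε →
  let B₁ , pos₁ , x≤ = Cauchy.bound (seq x) (cauchy x)
      B₂ , pos₂ , y′≤ = Cauchy.bound (seq y′) (cauchy y′)
      δ , 0<δ , Bδ≡ε = Cauchy.share (B₁ ℚ.+ B₂) ε (ℚ.pos+pos⇒pos B₁ {{pos₁}} B₂ {{pos₂}}) 0<ε
  in eventually-map₂ (λ n (x≤B₁ , y′≤B₂) (δx , δy) →
       Cauchy.*-close (seq x n) (seq y n) (seq x′ n) (seq y′ n) B₁ B₂ δ ε pos₁ pos₂ Bδ≡ε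
         x≤B₁ y′≤B₂ δx δy)
     (eventually-map₂ (λ _ → _,_) x≤ y′≤)
     (eventually-map₂ (λ _ → _,_) (x≈x′ δ 0<δ) (y≈y′ δ 0<δ))

ℝ-commutativeSemiring : CommutativeSemiring 0ℓ 0ℓ
ℝ-commutativeSemiring = record
  { Carrier = ℝ ; _≈_ = _≃_ ; _+_ = _+_ ; _*_ = _*_ ; 0# = 0ℝ ; 1# = 1ℝ
  ; isCommutativeSemiring = IsCommutativeSemiringˡ.isCommutativeSemiring record
    { +-isCommutativeMonoid = record
      { isMonoid = record
        { isSemigroup = record
          { isMagma = record { isEquivalence = ≃-isEquivalence ; ∙-cong = +-cong-≃ }
          ; assoc   = λ x y z → ≃-pointwise λ n → ℚ.+-assoc (seq x n) (seq y n) (seq z n)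
          }
        ; identity = (λ x → ≃-pointwise λ n → ℚ.+-identityˡ (seq x n))
                   , (λ x → ≃-pointwise λ n → ℚ.+-identityʳ (seq x n))
        }
      ; comm = λ x y → ≃-pointwise λ n → ℚ.+-comm (seq x n) (seq y n)
      }
    ; *-isCommutativeMonoid = record
      { isMonoid = record
        { isSemigroup = record
          { isMagma = record { isEquivalence = ≃-isEquivalence ; ∙-cong = *-cong-≃ }
          ; assoc   = λ x y z → ≃-pointwise λ n → ℚ.*-assoc (seq x n) (seq y n) (seq z n)
          }
        ; identity = (λ x → ≃-pointwise λ n → ℚ.*-identityˡ (seq x n))
                   , (λ x → ≃-pointwise λ n → ℚ.*-identityʳ (seq x n))
        }
      ; comm = λ x y → ≃-pointwise λ n → ℚ.*-comm (seq x n) (seq y n)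
      }
    ; distribʳ = λ x y z → ≃-pointwise λ n → ℚ.*-distribʳ-+ (seq x n) (seq y n) (seq z n)
    ; zeroˡ    = λ x → ≃-pointwise λ n → ℚ.*-zeroˡ (seq x n)
    }
  }
  where
  ≃-isEquivalence : IsEquivalence _≃_
  ≃-isEquivalence = record { refl = ≃-refl ; sym = ≃-sym ; trans = ≃-trans }

1≄0 : ¬ 1ℝ ≃ 0ℝ
-- The constant difference 1 exceeds the tolerance ½.
1≄0 (≈⇒≃ 1≈0) with 1≈0 ½ (ℚ.positive⁻¹ ½)
... | N , 1≤½ with 1≤½ N ℕ.≤-refl
...   | ℚ.*≤* (ℤ.+≤+ (ℕ.s≤s ()))

open CommutativeSemiring ℝ-commutativeSemiring using (setoid; reflexive)
module ≃-Reasoning = SetoidReasoning setoid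

-- Inverses of nonzero nonnegative reals.

module _ (η : ℚ) {{η-positive : ℚ.Positive η}} where

  ⊔-positive : ∀ q → ℚ.Positive (q ℚ.⊔ η)
  ⊔-positive q = ℚ.positive (ℚ.<-≤-trans (ℚ.positive⁻¹ η) (ℚ.p≤q⊔p q η))

  -- Total, and the reciprocal of q for q ≥ η.
  recip : ℚ → ℚ
  recip q = (ℚ.1/ (q ℚ.⊔ η)) {{ℚ.pos⇒nonZero (q ℚ.⊔ η) {{⊔-positive q}}}}

  recip-nonNeg : ∀ q → ℚ.NonNegative (recip q)
  recip-nonNeg q = ℚ.pos⇒nonNeg (recip q) {{ℚ.1/pos⇒pos (q ℚ.⊔ η) {{⊔-positive q}}}}

  recip-inverse : ∀ {q} → η ℚ.≤ q → q ℚ.* recip q ≡ 1ℚ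
  recip-inverse {q} η≤q = trans (cong (ℚ._* recip q) (sym (ℚ.p≥q⇒p⊔q≡p η≤q)))
    (ℚ.*-inverseʳ (q ℚ.⊔ η) {{ℚ.pos⇒nonZero (q ℚ.⊔ η) {{⊔-positive q}}}})

  -- The bound is `1/ η`: inserting 1 = η · (1/η) and enlarging `η` to `q` lets `recip q` cancel
  -- `q`.
  recip-bound : ∃[ K ] (ℚ.Positive K × ∀ {q} → η ℚ.≤ q → recip q ℚ.≤ K)
  recip-bound = K , ℚ.1/pos⇒pos η , λ {q} η≤q → begin
    recip q                  ≡⟨ ℚ.*-identityʳ (recip q) ⟨
    recip q ℚ.* 1ℚ           ≡⟨ cong (recip q ℚ.*_) (ℚ.*-inverseʳ η) ⟨
    recip q ℚ.* (η ℚ.* K)    ≤⟨ ℚ.*-monoˡ-≤-nonNeg (recip q) {{recip-nonNeg q}}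
                                  (ℚ.*-monoʳ-≤-nonNeg K {{ℚ.pos⇒nonNeg K {{ℚ.1/pos⇒pos η}}}} η≤q) ⟩
    recip q ℚ.* (q ℚ.* K)    ≡⟨ ℚ.*-assoc (recip q) q K ⟨
    (recip q ℚ.* q) ℚ.* K    ≡⟨ cong (ℚ._* K) (trans (ℚ.*-comm (recip q) q) (recip-inverse η≤q)) ⟩
    1ℚ ℚ.* K                 ≡⟨ ℚ.*-identityˡ K ⟩
    K                        ∎
    where
    open ℚ.≤-Reasoning
    instance
      nonZero-η : ℚ.NonZero η
      nonZero-η = ℚ.pos⇒nonZero η
    K = ℚ.1/ η

  -- The familiar 1/p - 1/q = (q - p)/(pq), with the factors nested so that the bound on `recip` can
  -- be applied twice.
  recip-difference : ∀ {p q} → η ℚ.≤ p → η ℚ.≤ q →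
    recip p ℚ.- recip q ≡ recip p ℚ.* (recip q ℚ.* (q ℚ.- p))
  recip-difference {p} {q} η≤p η≤q = begin
    recip p ℚ.- recip q
      ≡⟨ cong₂ ℚ._-_ (ℚ.*-identityʳ (recip p)) (ℚ.*-identityˡ (recip q)) ⟨
    recip p ℚ.* 1ℚ ℚ.- 1ℚ ℚ.* recip q
      ≡⟨ cong₂ (λ a b → recip p ℚ.* a ℚ.- b ℚ.* recip q) (recip-inverse η≤q) (recip-inverse η≤p) ⟨
    recip p ℚ.* (q ℚ.* recip q) ℚ.- (p ℚ.* recip p) ℚ.* recip q
      ≡⟨ solve 4 (λ p q a b → a :* (q :* b) :- (p :* a) :* b := a :* (b :* (q :- p))) refl
           p q (recip p) (recip q) ⟩
    recip p ℚ.* (recip q ℚ.* (q ℚ.- p)) ∎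
    where
    open ≡-Reasoning
    open +-*-Solver

  recip-cauchy : ∀ s → IsCauchy s → Eventually (λ n → η ℚ.≤ s n) → IsCauchy (λ n → recip (s n))
  recip-cauchy s cs (M , η≤s) ε 0<ε =
    let K , posK , recip≤K = recip-bound
        -- Two divisions by `K` give δ = ε / K², since each of the two reciprocals contributes a
        -- factor of at most `K`.
        δ₁ , 0<δ₁ , Kδ₁≡ε = Cauchy.share K ε posK 0<ε
        δ , 0<δ , Kδ≡δ₁ = Cauchy.share K δ₁ posK 0<δ₁
        N , close = cs δ 0<δ
        ∣recip∣≤K : ∀ {q} → η ℚ.≤ q → ∣ recip q ∣ ℚ.≤ K
        ∣recip∣≤K {q} η≤q = subst (ℚ._≤ K)
          (sym (ℚ.0≤p⇒∣p∣≡p (ℚ.nonNegative⁻¹ (recip q) {{recip-nonNeg q}}))) (recip≤K η≤q)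
    in M ℕ.⊔ N , λ m n m≥ n≥ →
       let η≤sm = η≤s m (ℕ.m⊔n≤o⇒m≤o M N m≥)
           η≤sn = η≤s n (ℕ.m⊔n≤o⇒m≤o M N n≥)
       in subst₂ ℚ._≤_ (cong ∣_∣ (sym (recip-difference η≤sm η≤sn))) Kδ₁≡ε
            (Cauchy.∣*∣-mono (recip (s m)) _ K δ₁ posK (∣recip∣≤K η≤sm)
              (subst (_ ℚ.≤_) Kδ≡δ₁
                (Cauchy.∣*∣-mono (recip (s n)) (s n ℚ.- s m) K δ posK (∣recip∣≤K η≤sn)
                  (close n m (ℕ.m⊔n≤o⇒n≤o M N n≥) (ℕ.m⊔n≤o⇒n≤o M N m≥)))))

-- A Cauchy sequence that exceeds ε infinitely often is eventually at least ½ ε.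
≄0⇒bounded-below : ExcludedMiddle 0ℓ → ∀ {x} → 0ℝ ≲ x → ¬ x ≃ 0ℝ →
  ∃[ η ] (ℚ.Positive η × Eventually λ n → η ℚ.≤ seq x n)
≄0⇒bounded-below em {x} 0≲x x≄0
  with em {∃[ ε ] (0ℚ ℚ.< ε × ¬ Eventually λ n → seq x n ℚ.≤ 0ℚ ℚ.+ ε)}
-- Excluded middle at each `ε` turns the absence of a persistent excess into x ≤ 0, which with 0 ≤ x
-- contradicts `x≄0`.
... | no ¬large = contradiction (≲-antisym (≤⇒≲ x≤0) 0≲x) x≄0
  where
  x≤0 : x ≤ 0ℝ
  x≤0 ε 0<ε with em {Eventually λ n → seq x n ℚ.≤ 0ℚ ℚ.+ ε}
  ... | yes small = small
  ... | no ¬small = contradiction (ε , 0<ε , ¬small) ¬large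
... | yes (ε , 0<ε , ¬small) =
  let N , close = cauchy x (½ ℚ.* ε) (Cauchy.half-pos 0<ε)
  -- A single term below ½ ε from `N` on would force all terms from `N` on to be at most `ε`.
  in ½ ℚ.* ε , ℚ.positive (Cauchy.half-pos 0<ε) , N , λ n n≥ → ℚ.≮⇒≥ λ xn<½ε →
     ¬small (N , λ m m≥ → begin
       seq x m                     ≤⟨ ∣p-q∣≤r⇒p≤q+r _ _ (close m n m≥ n≥) ⟩
       seq x n ℚ.+ ½ ℚ.* ε         ≤⟨ ℚ.+-monoˡ-≤ (½ ℚ.* ε) (ℚ.<⇒≤ xn<½ε) ⟩
       ½ ℚ.* ε ℚ.+ ½ ℚ.* ε         ≡⟨ Cauchy.halves ε ⟩
       ε                           ≡⟨ ℚ.+-identityˡ ε ⟨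
       0ℚ ℚ.+ ε                    ∎)
  where open ℚ.≤-Reasoning

-- The witness takes reciprocals term by term, cut off at a positive `η` that eventually bounds the
-- terms of `x` from below, so the product is exactly 1 from some index on. The last component keeps
-- probabilities nonnegative under division.
inverse : ExcludedMiddle 0ℓ → ∀ {x} → 0ℝ ≲ x → ¬ x ≃ 0ℝ →
  ∃[ y ] (x * y ≃ 1ℝ × ∀ z → 0ℝ ≲ z → 0ℝ ≲ z * y)
inverse em {x} 0≲x x≄0 with ≄0⇒bounded-below em 0≲x x≄0
... | η , posη , η≤x = y , x*y≃1 , *-nonneg
  where
  instance
    positive-η : ℚ.Positive η
    positive-η = posη

  y : ℝ
  seq y n  = recip η (seq x n)
  cauchy y = recip-cauchy η (seq x) (cauchy x) η≤x

  x*y≃1 : x * y ≃ 1ℝ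
  x*y≃1 = ≈⇒≃ λ ε 0<ε → eventually-map
    (λ n η≤xn → subst (λ q → ∣ q ℚ.- 1ℚ ∣ ℚ.≤ ε) (sym (recip-inverse η η≤xn)) (ℚ.<⇒≤ 0<ε)) η≤x

  *-nonneg : ∀ z → 0ℝ ≲ z → 0ℝ ≲ z * y
  *-nonneg z (≤⇒≲ 0≤z) = ≤⇒≲ λ ε 0<ε →
    let K , posK , recip≤K = recip-bound η
        -- Multiplying 0 ≤ zₙ + δ by a reciprocal of at most `K` costs an error of at most δ · K,
        -- hence δ = ε / K.
        δ , 0<δ , Kδ≡ε = Cauchy.share K ε posK 0<ε
    in eventually-map₂ (λ n 0≤zn+δ η≤xn → begin
         0ℚ
           ≡⟨ ℚ.*-zeroˡ (seq y n) ⟨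
         0ℚ ℚ.* seq y n
           ≤⟨ ℚ.*-monoʳ-≤-nonNeg (seq y n) {{recip-nonNeg η (seq x n)}} 0≤zn+δ ⟩
         (seq z n ℚ.+ δ) ℚ.* seq y n
           ≡⟨ ℚ.*-distribʳ-+ (seq y n) (seq z n) δ ⟩
         seq z n ℚ.* seq y n ℚ.+ δ ℚ.* seq y n
           ≤⟨ ℚ.+-monoʳ-≤ (seq z n ℚ.* seq y n)
                (ℚ.*-monoˡ-≤-nonNeg δ {{ℚ.nonNegative (ℚ.<⇒≤ 0<δ)}} (recip≤K η≤xn)) ⟩
         seq z n ℚ.* seq y n ℚ.+ δ ℚ.* K
           ≡⟨ cong (seq z n ℚ.* seq y n ℚ.+_) (trans (ℚ.*-comm δ K) Kδ≡ε) ⟩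
         seq z n ℚ.* seq y n ℚ.+ ε ∎)
       (0≤z δ 0<δ) η≤x
    where open ℚ.≤-Reasoning

-- Sums of reals over values and assignments.

open SemiringSums ℝ-commutativeSemiring using (normalize; *-null)

sum-cong : ∀ {n} {f g : Fin n → ℝ} → (∀ i → f i ≃ g i) → sum f ≃ sum g
sum-cong = SemiringSums.sum-cong-≋ ℝ-commutativeSemiring

sum-zero : ∀ n → sum {n} (λ _ → 0ℝ) ≃ 0ℝ
sum-zero = SemiringSums.sum-replicate-zero ℝ-commutativeSemiring

sum-comm : ∀ {m n} (f : Fin m → Fin n → ℝ) →
  sum (λ i → sum λ j → f i j) ≃ sum (λ j → sum λ i → f i j)
sum-comm = SemiringSums.∑-comm ℝ-commutativeSemiring

sum-single : ∀ {n} (f : Fin n → ℝ) i → (∀ j → j ≢ i → f j ≃ 0ℝ) → sum f ≃ f i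
sum-single = SemiringSums.sum-single ℝ-commutativeSemiring

sum-mono : ∀ {n} {f g : Fin n → ℝ} → (∀ i → f i ≲ g i) → sum f ≲ sum g
sum-mono = SemiringSums.sum-mono ℝ-commutativeSemiring _≲_ (≲-reflexive ≃-refl) +-mono-≲

product-chain : ∀ {n} (a p : Fin n → ℝ) (q : ℕ → ℝ) → q 0 ≃ 1ℝ →
  (∀ i → p i ≃ q (toℕ i)) → (∀ i → a i * p i ≃ q (suc (toℕ i))) → product a ≃ q n
product-chain = SemiringSums.product-chain ℝ-commutativeSemiring

sumAll-cong : ∀ {c n} {f g : Assignment c n → ℝ} → (∀ x → f x ≃ g x) → sumAll f ≃ sumAll g
sumAll-cong {n = zero}  f≃g = f≃g []
sumAll-cong {n = suc n} f≃g = sum-cong λ v → sumAll-cong λ x → f≃g (v ∷ x)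

sumAll-mono : ∀ {c n} {f g : Assignment c n → ℝ} → (∀ x → f x ≲ g x) → sumAll f ≲ sumAll g
sumAll-mono {n = zero}  f≲g = f≲g []
sumAll-mono {n = suc n} f≲g = sum-mono λ v → sumAll-mono λ x → f≲g (v ∷ x)

sumAll-zero : ∀ {c} n → sumAll {c} {n} (λ _ → 0ℝ) ≃ 0ℝ
sumAll-zero         zero    = ≃-refl
sumAll-zero {c = c} (suc n) = ≃-trans (sum-cong {c} λ _ → sumAll-zero n) (sum-zero c)

sumAll-single : ∀ {c n} (f : Assignment c n → ℝ) x → (∀ y → y ≢ x → f y ≃ 0ℝ) → sumAll f ≃ f x
sumAll-single             f []      f≃0 = ≃-refl
sumAll-single {n = suc n} f (v ∷ x) f≃0 = ≃-trans
  (sum-single _ v λ w w≢v → ≃-trans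
    (sumAll-cong λ y → f≃0 (w ∷ y) (w≢v ∘ Vec.∷-injectiveˡ)) (sumAll-zero n))
  (sumAll-single (f ∘ (v ∷_)) x λ y y≢x → f≃0 (v ∷ y) (y≢x ∘ Vec.∷-injectiveʳ))

sum-sumAll-comm : ∀ {c m n} (f : Fin m → Assignment c n → ℝ) →
  sum (λ i → sumAll (f i)) ≃ sumAll (λ x → sum λ i → f i x)
sum-sumAll-comm {n = zero}  f = ≃-refl
sum-sumAll-comm {n = suc n} f = ≃-trans
  (sum-comm λ i v → sumAll λ x → f i (v ∷ x))
  (sum-cong λ v → sum-sumAll-comm λ i x → f i (v ∷ x))

-- Probabilities of events.

module _ {c n : ℕ} (P : Distribution c n) where
  open IsDistribution (isDistribution P)

  Pr-cong : ∀ {E F} → (∀ x → E x ≡ F x) → Pr P E ≃ Pr P F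
  Pr-cong {E} {F} E≗F = sumAll-cong λ x →
    reflexive (cong (λ b → if b then mass P x else 0ℝ) (E≗F x))

  Pr-nonneg : ∀ E → 0ℝ ≲ Pr P E
  Pr-nonneg E = ≲-trans (≲-reflexive (≃-sym (sumAll-zero {c} n)))
    (sumAll-mono {f = λ _ → 0ℝ} {λ x → if E x then mass P x else 0ℝ} λ x → 0≲term (E x) x)
    where
    0≲term : ∀ b x → 0ℝ ≲ (if b then mass P x else 0ℝ)
    0≲term true  x = ≤⇒≲ (nonneg x)
    0≲term false x = ≲-reflexive ≃-refl

  Pr-total : Pr P (λ _ → true) ≃ 1ℝ
  Pr-total = ≈⇒≃ total

  -- Makes a conjunction null as soon as `F` is null.
  Pr-∧≲ : ∀ (E F : Assignment c n → Bool) → Pr P (λ x → E x ∧ F x) ≲ Pr P F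
  Pr-∧≲ E F = sumAll-mono
    {f = λ x → if E x ∧ F x then mass P x else 0ℝ} {λ x → if F x then mass P x else 0ℝ}
    λ x → term≲ (E x) (F x) x
    where
    term≲ : ∀ b d x → (if b ∧ d then mass P x else 0ℝ) ≲ (if d then mass P x else 0ℝ)
    term≲ true  d     x = ≲-reflexive ≃-refl
    term≲ false true  x = ≤⇒≲ (nonneg x)
    term≲ false false x = ≲-reflexive ≃-refl

  Pr-singleton : ∀ E x → E x ≡ true → (∀ y → y ≢ x → E y ≡ false) → Pr P E ≃ mass P x
  Pr-singleton E x Ex≡true Ey≡false = begin
    Pr P E
      ≈⟨ sumAll-single _ x (λ y y≢x →
           reflexive (cong (λ b → if b then mass P y else 0ℝ) (Ey≡false y y≢x))) ⟩
    (if E x then mass P x else 0ℝ)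
      ≡⟨ cong (λ b → if b then mass P x else 0ℝ) Ex≡true ⟩
    mass P x ∎
    where open ≃-Reasoning

  -- Exchanging the sums leaves, for each assignment, only the term where `v` is its own value at
  -- `i`.
  Pr-partition : ∀ i E → sum (λ v → Pr P (λ x → does (lookup x i Fin.≟ v) ∧ E x)) ≃ Pr P E
  Pr-partition i E = ≃-trans
    (sum-sumAll-comm λ v x → if does (lookup x i Fin.≟ v) ∧ E x then mass P x else 0ℝ)
    (sumAll-cong λ x → ≃-trans
      (sum-single _ (lookup x i) λ v v≢xi → reflexive
        (cong (λ b → if b ∧ E x then mass P x else 0ℝ)
          (dec-false (lookup x i Fin.≟ v) (v≢xi ∘ sym))))
      (reflexive
        (cong (λ b → if b ∧ E x then mass P x else 0ℝ)
          (dec-true (lookup x i Fin.≟ lookup x i) refl))))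

-- Rows of conditional probabilities.

-- The condition is multiplied out, as in `cpt-conditional`, so that null events have rows too. `E`
-- is arbitrary, which covers both parent events and the sure event.
record ConditionalRow {c n : ℕ} (P : Distribution c n) (i : Fin n) (E : Assignment c n → Bool) :
  Set where
  field
    row                : Val c → ℝ
    row-isDistribution : IsDistribution sum row
    row-conditional    : ∀ v → row v * Pr P E ≃ Pr P (λ x → does (lookup x i Fin.≟ v) ∧ E x)

module _ (em : ExcludedMiddle 0ℓ) {c n : ℕ} (P : Distribution c n) where
  -- The quotients add up to 1 because the values of variable `i` partition `E`.
  conditional-nonzero : ∀ i E → ¬ Pr P E ≃ 0ℝ → ConditionalRow P i E
  conditional-nonzero i E PrE≄0 =
    let y , PrE*y≃1 , *-nonneg = inverse em (Pr-nonneg P E) PrE≄0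
        row , row-nonneg , row-total , row-conditional =
          normalize (0ℝ ≲_) (λ v → Pr P (λ x → does (lookup x i Fin.≟ v) ∧ E x)) (Pr P E) y
            (Pr-partition P i E) PrE*y≃1 *-nonneg
            (λ v → Pr-nonneg P (λ x → does (lookup x i Fin.≟ v) ∧ E x))
    in record
      { row                = row
      ; row-isDistribution = record { nonneg = λ v → ≲⇒≤ (row-nonneg v) ; total = ≃⇒≈ row-total }
      ; row-conditional    = row-conditional
      }

  conditional : ∀ i E → ConditionalRow P i E
  conditional i E = case em {Pr P E ≃ 0ℝ} of λ where
    (no  PrE≄0) → conditional-nonzero i E PrE≄0
    (yes PrE≃0) →
      -- Conditioning on the sure event, whose probability 1 is nonzero, yields the marginal of
      -- variable `i` as the default row.
      let open ConditionalRow (conditional-nonzero i (λ _ → true)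
            (λ total≃0 → 1≄0 (≃-trans (≃-sym (Pr-total P)) total≃0)))
      in record
        { row                = row
        ; row-isDistribution = row-isDistribution
        -- Both sides vanish, since the joint event is contained in the null event `E`.
        ; row-conditional    = λ v →
            *-null (row v) (Pr P E) (Pr P (λ x → does (lookup x i Fin.≟ v) ∧ E x)) PrE≃0
              (≲-antisym
                (≲-trans (Pr-∧≲ P (λ x → does (lookup x i Fin.≟ v)) E) (≲-reflexive PrE≃0))
                (Pr-nonneg P (λ x → does (lookup x i Fin.≟ v) ∧ E x)))
        }

-- Parent values in the complete DAG.

-- Reduces equality of tuples of parent values to agreement at each parent, free of list positions.
map-fromList-≡ : ∀ {A B : Set} {f g : A → B} (xs : List A) →
  Vec.map f (Vec.fromList xs) ≡ Vec.map g (Vec.fromList xs) ⇔ (∀ {x} → x ∈ xs → f x ≡ g x)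
map-fromList-≡ {f = f} {g} xs = mk⇔ (to xs) (from xs)
  where
  to : ∀ xs → Vec.map f (Vec.fromList xs) ≡ Vec.map g (Vec.fromList xs) →
    ∀ {x} → x ∈ xs → f x ≡ g x
  to (x List.∷ xs) eq (here refl)  = Vec.∷-injectiveˡ eq
  to (x List.∷ xs) eq (there x∈xs) = to xs (Vec.∷-injectiveʳ eq) x∈xs

  from : ∀ xs → (∀ {x} → x ∈ xs → f x ≡ g x) →
    Vec.map f (Vec.fromList xs) ≡ Vec.map g (Vec.fromList xs)
  from List.[]       f≗g = refl
  from (x List.∷ xs) f≗g = cong₂ _∷_ (f≗g (here refl)) (from xs (f≗g ∘ there))

-- The bound is a natural number rather than an index, since the telescoping needs prefixes of every
-- length from 0 to `n`.
AgreeBelow : ∀ {c n} → ℕ → Assignment c n → Assignment c n → Set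
AgreeBelow k x y = ∀ j → toℕ j ℕ.< k → lookup y j ≡ lookup x j

agreeBelow? : ∀ {c n} k (x y : Assignment c n) → Dec (AgreeBelow k x y)
agreeBelow? k x y = Fin.all? λ j → (toℕ j ℕ.<? k) →-dec (lookup y j Fin.≟ lookup x j)

agreeBelow-suc : ∀ {c n} i (x y : Assignment c n) →
  (lookup y i ≡ lookup x i × AgreeBelow (toℕ i) x y) ⇔ AgreeBelow (suc (toℕ i)) x y
agreeBelow-suc i x y = mk⇔
  (λ (yi≡xi , agree) j j≤i → case ℕ.m≤n⇒m<n∨m≡n (ℕ.s≤s⁻¹ j≤i) of λ where
    (inj₁ j<i) → agree j j<i
    (inj₂ j≡i) → subst (λ k → lookup y k ≡ lookup x k) (sym (Fin.toℕ-injective j≡i)) yi≡xi)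
  (λ agree → agree i ℕ.≤-refl , λ j j<i → agree j (ℕ.m<n⇒m<1+n j<i))

module _ {n : ℕ} where
  open DAG (completeDAG n)

  -- The parents of `i` are filtered from all variables by the edge relation `Fin._<_`, so they are
  -- exactly the preceding ones.
  parentValues-≡ : ∀ {c} i (x y : Assignment c n) →
    parentValues i y ≡ parentValues i x ⇔ AgreeBelow (toℕ i) x y
  parentValues-≡ i x y = mk⇔
    (λ eq j j<i → Equivalence.to (map-fromList-≡ (parents i)) eq
      (∈-filter⁺ (Fin._<? i) (∈-allFin j) j<i))
    (λ agree → Equivalence.from (map-fromList-≡ (parents i))
      λ {j} j∈ → agree j (proj₂ (∈-filter⁻ (Fin._<? i) {xs = List.allFin n} j∈)))

-- The chain rule over the complete DAG.

module _ {c n : ℕ} (P : Distribution c n)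
  (rows : ∀ i (pa : DAG.ParentValues (completeDAG n) c i) →
    ConditionalRow P i (DAG.hasParentValues (completeDAG n) i pa)) where
  open ConditionalRow

  Pr-agreeBelow : Assignment c n → ℕ → ℝ
  Pr-agreeBelow x k = Pr P (λ y → does (agreeBelow? k x y))

  Pr-parentValues : ∀ x i →
    Pr P (DAG.hasParentValues (completeDAG n) i (DAG.parentValues (completeDAG n) i x))
      ≃ Pr-agreeBelow x (toℕ i)
  Pr-parentValues x i = Pr-cong P λ y → does-⇔ (parentValues-≡ i x y)
    (Vec.≡-dec Fin._≟_ (DAG.parentValues (completeDAG n) i y)
                       (DAG.parentValues (completeDAG n) i x))
    (agreeBelow? (toℕ i) x y)

  Pr-value∧parentValues : ∀ x i →
    Pr P (λ y → does (lookup y i Fin.≟ lookup x i)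
        ∧ DAG.hasParentValues (completeDAG n) i (DAG.parentValues (completeDAG n) i x) y)
      ≃ Pr-agreeBelow x (suc (toℕ i))
  Pr-value∧parentValues x i = Pr-cong P λ y →
    -- `does` of a `×-dec` computes to the conjunction of the two tests, so the event is the
    -- decision of a pair.
    does-⇔ (agreeBelow-suc i x y ⇔-∘ (⇔-id (lookup y i ≡ lookup x i) ×-⇔ parentValues-≡ i x y))
      ((lookup y i Fin.≟ lookup x i)
        ×-dec Vec.≡-dec Fin._≟_ (DAG.parentValues (completeDAG n) i y)
                                (DAG.parentValues (completeDAG n) i x))
      (agreeBelow? (suc (toℕ i)) x y)

  row*Pr-parentValues : ∀ x i →
    row (rows i (DAG.parentValues (completeDAG n) i x)) (lookup x i)
      * Pr P (DAG.hasParentValues (completeDAG n) i (DAG.parentValues (completeDAG n) i x))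
      ≃ Pr-agreeBelow x (suc (toℕ i))
  row*Pr-parentValues x i = ≃-trans
    (row-conditional (rows i (DAG.parentValues (completeDAG n) i x)) (lookup x i))
    (Pr-value∧parentValues x i)

  Pr-agreeBelow-zero : ∀ x → Pr-agreeBelow x 0 ≃ 1ℝ
  Pr-agreeBelow-zero x = ≃-trans
    (Pr-cong P λ y → dec-true (agreeBelow? 0 x y) λ _ ())
    (Pr-total P)

  -- Agreement on all `n` variables is equality, so the event contains `x` alone.
  Pr-agreeBelow-all : ∀ x → Pr-agreeBelow x n ≃ mass P x
  Pr-agreeBelow-all x = Pr-singleton P _ x
    (dec-true (agreeBelow? n x x) λ _ _ → refl)
    (λ y y≢x → dec-false (agreeBelow? n x y) λ agree → y≢x
      (Pointwise-≡⇒≡ (Pointwise.ext λ j → agree j (Fin.toℕ<n j))))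

  -- The telescoping draws only on `row-conditional`, so it holds whatever rows are chosen at null
  -- parent values.
  product≃Pr-agreeBelow : ∀ x →
    product (λ i → row (rows i (DAG.parentValues (completeDAG n) i x)) (lookup x i))
      ≃ Pr-agreeBelow x n
  product≃Pr-agreeBelow x = product-chain
    (λ i → row (rows i (DAG.parentValues (completeDAG n) i x)) (lookup x i))
    (λ i → Pr P (DAG.hasParentValues (completeDAG n) i (DAG.parentValues (completeDAG n) i x)))
    (Pr-agreeBelow x)
    (Pr-agreeBelow-zero x) (Pr-parentValues x) (row*Pr-parentValues x)

  chain-rule : ∀ x →
    mass P x ≃ product (λ i → row (rows i (DAG.parentValues (completeDAG n) i x)) (lookup x i))
  chain-rule x = ≃-trans (≃-sym (Pr-agreeBelow-all x)) (≃-sym (product≃Pr-agreeBelow x))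

  completeNetwork : BayesianNetwork c (completeDAG n)
  completeNetwork = record
    { joint              = P
    ; cpt                = λ i pa → row (rows i pa)
    ; cpt-isDistribution = λ i pa → row-isDistribution (rows i pa)
    ; cpt-conditional    = λ i pa v → ≃⇒≈ (row-conditional (rows i pa) v)
    ; factorizes         = λ x → ≃⇒≈ (chain-rule x)
    }

proposition2 : ExcludedMiddle 0ℓ →
    ∀ (l : Label) (c n : ℕ) (φ : Formula l c n) →
    SAT φ ⇔ SAT-DAG φ (completeDAG n)
proposition2 em l c n φ = mk⇔
  -- Both directions keep the distribution, so the proof that it satisfies `φ` is reused unchanged;
  -- only the network structure is added or forgotten.
  (λ (P , P⊨φ) → completeNetwork P (λ i pa → conditional em P i _) , P⊨φ)
  (λ (B , B⊨φ) → joint B , B⊨φ)
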